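{- Let $x_0\in\mathbb{N}$, with associated orbit $(x_n)_{n\ge0}$ and word $w$. For all $a,b,m\in\mathbb{N}$, the length-$m$ factors of $w$ at $a$ and at $b$ agree (that is, $w_{a+i}=w_{b+i}$ for all $0\le i<m$) if and only if $2^m\mid x_b-x_a$ in $\mathbb{Z}$.
   Context: Here $\mathbb{N}=\{0,1,2,\dots\}$. For $x_0\in\mathbb{N}$ the orbit is defined by $x_{n+1}=\lceil 3x_n/2\rceil$ for $n\ge0$, and the word $w=(w_n)_{n\ge0}$ by $w_n=x_n\bmod 2\in\{0,1\}$; equivalently $w_n=2x_{n+1}-3x_n$. -}

module Defs where

open import Data.Nat using (ℕ; zero; suc; _*_; ⌈_/2⌉)
open import Data.Nat.DivMod using (_%_)

orbit : ℕ → ℕ → ℕ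
orbit x₀ zero    = x₀
orbit x₀ (suc n) = ⌈ 3 * orbit x₀ n /2⌉

word : ℕ → ℕ → ℕ
word x₀ n = orbit x₀ n % 2

{-# OPTIONS --safe #-}

-- From 2⌈3x/2⌉ = 3x + (x mod 2), consecutive differences of orbit values satisfy
--   2 (x_{b+1} − x_{a+1}) = 3 (x_b − x_a) + (w_b − w_a).
-- So if w_a = w_b then, 3 being invertible modulo powers of 2,
-- 2^{m+1} ∣ x_b − x_a iff 2^m ∣ x_{b+1} − x_{a+1}; conversely 2 ∣ x_b − x_a
-- forces w_a = w_b. Induct on m.
module Submission where

open import Defs
open import Data.Nat using (ℕ; zero; suc; _+_; _*_; _^_; _<_; s≤s; z<s; s<s; ⌈_/2⌉)
open import Data.Nat.Properties using (+-suc; +-identityʳ; *-suc)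
open import Data.Nat.DivMod using (_%_; m%n<n; [m+kn]%n≡m%n)
import Data.Nat.Divisibility as ℕ
open import Data.Nat.Coprimality using (Coprime; coprime?; coprime-divisor; 1-coprimeTo)
open import Data.Nat.Tactic.RingSolver using () renaming (solve-∀ to ℕ-solve-∀)
import Data.Integer as ℤ
open import Data.Integer using (ℤ; +_; _-_)
import Data.Integer.Properties as ℤ
import Data.Integer.Coprimality as ℤ
open import Data.Integer.Tactic.RingSolver using (solve-∀)
open import Data.Integer.Divisibility.Signed using
  (_∣_; divides; ∣ᵤ⇒∣; ∣⇒∣ᵤ; ∣-trans; ∣n⇒∣m*n; ∣m⇒∣m*n; ∣-refl; ∣m+n∣m⇒∣n; *-monoʳ-∣; *-cancelˡ-∣)
open import Data.Product using (_,_)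
open import Function.Base using (_∘_)
open import Function.Bundles using (_⇔_; mk⇔)
open import Relation.Nullary.Decidable using (from-yes)
open import Relation.Binary.PropositionalEquality
  using (_≡_; refl; sym; trans; cong; cong₂; subst; subst₂; module ≡-Reasoning)

2*⌈n/2⌉≡n+n%2 : ∀ n → 2 * ⌈ n /2⌉ ≡ n + n % 2
2*⌈n/2⌉≡n+n%2 zero          = refl
2*⌈n/2⌉≡n+n%2 (suc zero)    = refl
-- `suc (suc n) % 2` reduces to `n % 2`, so both sides grow by exactly 2.
2*⌈n/2⌉≡n+n%2 (suc (suc n)) =
  trans (*-suc 2 ⌈ n /2⌉) (cong (suc ∘ suc) (2*⌈n/2⌉≡n+n%2 n))

-- Since 3x = x + 2x, the parity of 3x is that of x; the rounding error is thus the letter of the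
-- word.
2*⌈3*x/2⌉≡3*x+x%2 : ∀ x → 2 * ⌈ 3 * x /2⌉ ≡ 3 * x + x % 2
2*⌈3*x/2⌉≡3*x+x%2 x = trans (2*⌈n/2⌉≡n+n%2 (3 * x)) (cong (λ r → 3 * x + r) 3x%2≡x%2)
  where
  3x≡x+x*2 : ∀ x → 3 * x ≡ x + x * 2
  3x≡x+x*2 = ℕ-solve-∀

  3x%2≡x%2 : 3 * x % 2 ≡ x % 2
  3x%2≡x%2 = trans (cong (_% 2) (3x≡x+x*2 x)) ([m+kn]%n≡m%n x x 2)

2^m-coprime-3 : ∀ m → Coprime (2 ^ m) 3
2^m-coprime-3 zero            = 1-coprimeTo 3
2^m-coprime-3 (suc m) {d} (d∣2*2^m , d∣3) =
  2^m-coprime-3 m (coprime-divisor d-coprime-2 d∣2*2^m , d∣3)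
  where
  -- A common divisor of `d` and 2 divides both 3 and 2, hence is 1; so `d` can shed the factor 2
  -- and divides `2 ^ m`.
  d-coprime-2 : Coprime d 2
  d-coprime-2 (e∣d , e∣2) = from-yes (coprime? 3 2) (ℕ.∣-trans e∣d d∣3 , e∣2)

-- Euclid's lemma, applied to absolute values and transported back to signed divisibility.
2^m∣3*i⇒2^m∣i : ∀ m i → + (2 ^ m) ∣ + 3 ℤ.* i → + (2 ^ m) ∣ i
2^m∣3*i⇒2^m∣i m i = ∣ᵤ⇒∣ ∘ ℤ.coprime-divisor (+ (2 ^ m)) (+ 3) i (2^m-coprime-3 m) ∘ ∣⇒∣ᵤ

-- Distinct residues modulo 2 differ by 1 in absolute value, and 2 dividing that would give 2 ≤ 1.
<2∧2∣-⇒≡ : ∀ {r s} → r < 2 → s < 2 → + 2 ∣ + s - + r → r ≡ s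
<2∧2∣-⇒≡ {0} {0} _ _ _ = refl
<2∧2∣-⇒≡ {1} {1} _ _ _ = refl
<2∧2∣-⇒≡ {0} {1} _ _ 2∣1 with ℕ.∣⇒≤ (∣⇒∣ᵤ 2∣1)
... | s≤s ()
<2∧2∣-⇒≡ {1} {0} _ _ 2∣-1 with ℕ.∣⇒≤ (∣⇒∣ᵤ 2∣-1)
... | s≤s ()
<2∧2∣-⇒≡ {suc (suc _)} (s≤s (s≤s ()))
<2∧2∣-⇒≡ {_} {suc (suc _)} _ (s≤s (s≤s ()))

module _ (x₀ : ℕ) where

  private
    x w : ℕ → ℤ
    x n = + orbit x₀ n
    w n = + word x₀ n

  orbit-suc : ∀ n → + 2 ℤ.* x (suc n) ≡ + 3 ℤ.* x n ℤ.+ w n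
  orbit-suc n = begin
    + 2 ℤ.* x (suc n)             ≡⟨ ℤ.pos-* 2 (orbit x₀ (suc n)) ⟨
    + (2 * orbit x₀ (suc n))      ≡⟨ cong +_ (2*⌈3*x/2⌉≡3*x+x%2 (orbit x₀ n)) ⟩
    + (3 * orbit x₀ n) ℤ.+ w n    ≡⟨ cong (ℤ._+ w n) (ℤ.pos-* 3 (orbit x₀ n)) ⟩
    + 3 ℤ.* x n ℤ.+ w n           ∎
    where open ≡-Reasoning

  orbit-suc-difference : ∀ a b →
    + 2 ℤ.* (x (suc b) - x (suc a)) ≡ + 3 ℤ.* (x b - x a) ℤ.+ (w b - w a)
  orbit-suc-difference a b = begin
    + 2 ℤ.* (x (suc b) - x (suc a))                       ≡⟨ distrib (x (suc b)) (x (suc a)) ⟩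
    + 2 ℤ.* x (suc b) - + 2 ℤ.* x (suc a)                 ≡⟨ cong₂ _-_ (orbit-suc b) (orbit-suc a) ⟩
    (+ 3 ℤ.* x b ℤ.+ w b) - (+ 3 ℤ.* x a ℤ.+ w a)         ≡⟨ regroup (x b) (w b) (x a) (w a) ⟩
    + 3 ℤ.* (x b - x a) ℤ.+ (w b - w a)                   ∎
    where
    open ≡-Reasoning
    distrib : ∀ i j → + 2 ℤ.* (i - j) ≡ + 2 ℤ.* i - + 2 ℤ.* j
    distrib = solve-∀
    regroup : ∀ i k j l →
      (+ 3 ℤ.* i ℤ.+ k) - (+ 3 ℤ.* j ℤ.+ l) ≡ + 3 ℤ.* (i - j) ℤ.+ (k - l)
    regroup = solve-∀

  word≡⇒orbit-suc-difference : ∀ a b → word x₀ a ≡ word x₀ b →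
    + 2 ℤ.* (x (suc b) - x (suc a)) ≡ + 3 ℤ.* (x b - x a)
  word≡⇒orbit-suc-difference a b wa≡wb = begin
    + 2 ℤ.* (x (suc b) - x (suc a))         ≡⟨ orbit-suc-difference a b ⟩
    + 3 ℤ.* (x b - x a) ℤ.+ (w b - w a)     ≡⟨ cong (λ r → + 3 ℤ.* (x b - x a) ℤ.+ r)
                                                    (ℤ.i≡j⇒i-j≡0 (cong +_ (sym wa≡wb))) ⟩
    + 3 ℤ.* (x b - x a) ℤ.+ + 0             ≡⟨ ℤ.+-identityʳ _ ⟩
    + 3 ℤ.* (x b - x a)                     ∎
    where open ≡-Reasoning

  -- In the difference identity 2 divides the left side and `+ 3 ℤ.* (x b - x a)`, hence also
  -- `w b - w a`, a difference of two residues below 2.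
  2∣orbit-difference⇒word≡ : ∀ a b → + 2 ∣ x b - x a → word x₀ a ≡ word x₀ b
  2∣orbit-difference⇒word≡ a b 2∣d =
    <2∧2∣-⇒≡ (m%n<n (orbit x₀ a) 2) (m%n<n (orbit x₀ b) 2)
      (∣m+n∣m⇒∣n
        (subst (+ 2 ∣_) (orbit-suc-difference a b) (∣m⇒∣m*n _ ∣-refl))
        (∣n⇒∣m*n (+ 3) 2∣d))

  -- Doubling the later difference gains one power of 2; the factor 3 is then cancelled.
  2^[1+m]∣orbit-difference : ∀ m a b → word x₀ a ≡ word x₀ b →
    + (2 ^ m) ∣ x (suc b) - x (suc a) → + (2 ^ suc m) ∣ x b - x a
  2^[1+m]∣orbit-difference m a b wa≡wb 2^m∣d =
    2^m∣3*i⇒2^m∣i (suc m) _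
      (subst₂ _∣_ (sym (ℤ.pos-* 2 (2 ^ m))) (word≡⇒orbit-suc-difference a b wa≡wb)
        (*-monoʳ-∣ (+ 2) 2^m∣d))

  2^m∣orbit-suc-difference : ∀ m a b → word x₀ a ≡ word x₀ b →
    + (2 ^ suc m) ∣ x b - x a → + (2 ^ m) ∣ x (suc b) - x (suc a)
  2^m∣orbit-suc-difference m a b wa≡wb 2^[1+m]∣d =
    *-cancelˡ-∣ (+ 2)
      (subst₂ _∣_ (ℤ.pos-* 2 (2 ^ m)) (sym (word≡⇒orbit-suc-difference a b wa≡wb))
        (∣n⇒∣m*n (+ 3) 2^[1+m]∣d))

  factors≡⇒2^m∣ : ∀ m a b → (∀ i → i < m → word x₀ (a + i) ≡ word x₀ (b + i)) →
    + (2 ^ m) ∣ x b - x a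
  -- `2 ^ 0` is 1, so the difference is its own quotient.
  factors≡⇒2^m∣ zero    a b _  = divides (x b - x a) (sym (ℤ.*-identityʳ _))
  factors≡⇒2^m∣ (suc m) a b eq =
    2^[1+m]∣orbit-difference m a b
      (subst₂ (λ k l → word x₀ k ≡ word x₀ l) (+-identityʳ a) (+-identityʳ b) (eq 0 z<s))
      -- Letter `suc i` of the factor at `a` is letter `i` of the factor at `suc a`, so both
      -- starting points move in the induction.
      (factors≡⇒2^m∣ m (suc a) (suc b) λ i i<m →
        subst₂ (λ k l → word x₀ k ≡ word x₀ l) (+-suc a i) (+-suc b i) (eq (suc i) (s<s i<m)))

  2^m∣⇒factors≡ : ∀ m a b → + (2 ^ m) ∣ x b - x a →
    ∀ i → i < m → word x₀ (a + i) ≡ word x₀ (b + i)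
  -- Length 0 has no clause because `i < 0` is empty.
  2^m∣⇒factors≡ (suc m) a b 2^[1+m]∣d = λ where
      zero    _         → subst₂ (λ k l → word x₀ k ≡ word x₀ l)
                            (sym (+-identityʳ a)) (sym (+-identityʳ b)) wa≡wb
      (suc i) (s≤s i<m) → subst₂ (λ k l → word x₀ k ≡ word x₀ l)
                            (sym (+-suc a i)) (sym (+-suc b i))
                            (2^m∣⇒factors≡ m (suc a) (suc b)
                              (2^m∣orbit-suc-difference m a b wa≡wb 2^[1+m]∣d) i i<m)
    where
    wa≡wb : word x₀ a ≡ word x₀ b
    -- As `2 ^ suc m` is `2 * 2 ^ m`, the hypothesis makes the difference even.
    wa≡wb = 2∣orbit-difference⇒word≡ a b (∣-trans (∣ᵤ⇒∣ (ℕ.m∣m*n (2 ^ m))) 2^[1+m]∣d)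

theorem4p2 : ∀ (x₀ a b m : ℕ) →
    (∀ (i : ℕ) → i < m → word x₀ (a + i) ≡ word x₀ (b + i))
    ⇔ ((+ (2 ^ m)) ∣ ((+ orbit x₀ b) - (+ orbit x₀ a)))
theorem4p2 x₀ a b m = mk⇔ (factors≡⇒2^m∣ x₀ m a b) (2^m∣⇒factors≡ x₀ m a b)
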